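{- For any integer $k\geq 1$ there exist a finite abelian group $G$ and a generating set $B\subseteq G$ such that the Cayley graph $\mathrm{Cay}(G,B)$ has undirected diameter at most $2$, contains a directed cycle, and the length of its shortest directed cycle is at least $k$.
   Context: For a finite group $G$ (written additively when abelian) and a generating set $B\subseteq G$, the Cayley graph $\mathrm{Cay}(G,B)$ is the directed graph with vertex set $G$ in which there is a directed edge from $x$ to $y$ if and only if $y=x+g$ for some $g\in B$. The undirected diameter of a directed graph is the maximum distance between two vertices when edge orientations are ignored. A directed cycle of length $\ell\geq1$ is a closed path of $\ell$ edges respecting edge orientations (a loop is a directed cycle of length 1). -}

module Defs where

open import Algebra.Bundles using (Group)
open import Data.Fin.Base using (Fin; zero; suc; inject₁; fromℕ)
open import Data.Fin.Properties using (≡-setoid)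
open import Data.Nat.Base using (ℕ; _≤_)
open import Data.Product.Base using (_×_; ∃; ∃₂)
open import Function.Bundles using (Inverse)
open import Level using (Level; _⊔_)
open import Relation.Binary.Bundles using (Setoid)
open import Relation.Binary.Construct.Closure.Symmetric using (SymClosure)
open import Relation.Binary.Core using (Rel)
open import Relation.Binary.Definitions using (_Respects_)
open import Relation.Binary.PropositionalEquality.Core using (_≡_)
open import Relation.Unary using (Pred; Decidable)

Finite : {c ℓ : Level} → Setoid c ℓ → Set (c ⊔ ℓ)
Finite S = ∃ λ n → Inverse (≡-setoid n) S

IsLeast : {p : Level} → Pred ℕ p → ℕ → Set p
IsLeast P n = P n × (∀ m → P m → n ≤ m)

-- Directed graphs (loops allowed) are given by an edge relation _⟶_ on the
-- carrier of a setoid, whose equality is the equality of vertices.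

module Digraph {c ℓ e : Level} (V : Setoid c ℓ)
               (_⟶_ : Rel (Setoid.Carrier V) e) where

  open Setoid V renaming (Carrier to Vertex)

  IsWalk : {r : Level} → Rel Vertex r → (n : ℕ) → (Fin (ℕ.suc n) → Vertex) → Set r
  IsWalk R n v = ∀ (i : Fin n) → R (v (inject₁ i)) (v (suc i))

  UndirectedWalk : Vertex → Vertex → ℕ → Set (c ⊔ ℓ ⊔ e)
  UndirectedWalk x y n =
    ∃ λ v → IsWalk (SymClosure _⟶_) n v × v zero ≈ x × v (fromℕ n) ≈ y

  IsUndirectedDistance : Vertex → Vertex → ℕ → Set (c ⊔ ℓ ⊔ e)
  IsUndirectedDistance x y = IsLeast (UndirectedWalk x y)

  -- The first conjunct asks every pair of vertices to have a distance, so a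
  -- disconnected graph has no diameter.
  IsUndirectedDiameter : ℕ → Set (c ⊔ ℓ ⊔ e)
  IsUndirectedDiameter d =
    (∀ x y → ∃ λ n → IsUndirectedDistance x y n × n ≤ d) ×
    (∃₂ λ x y → IsUndirectedDistance x y d)

  -- The vertices v₀, …, vₙ₋₁ are pairwise distinct and vₙ is v₀ again.
  DirectedCycle : ℕ → Set (c ⊔ ℓ ⊔ e)
  DirectedCycle n =
    1 ≤ n ×
    (∃ λ v → IsWalk _⟶_ n v × v (fromℕ n) ≈ v zero ×
             (∀ (i j : Fin n) → v (inject₁ i) ≈ v (inject₁ j) → i ≡ j))

  IsShortestCycleLength : ℕ → Set (c ⊔ ℓ ⊔ e)
  IsShortestCycleLength = IsLeast DirectedCycle

module _ {c ℓ : Level} (G : Group c ℓ) where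

  open Group G

  -- Membership is decidable, as it is classically for subsets of a finite set.
  IsSubset : {p : Level} → Pred Carrier p → Set (c ⊔ ℓ ⊔ p)
  IsSubset B = B Respects _≈_ × Decidable B

  data Span {p : Level} (B : Pred Carrier p) : Pred Carrier (c ⊔ ℓ ⊔ p) where
    gen  : ∀ {x} → B x → Span B x
    unit : Span B ε
    mul  : ∀ {x y} → Span B x → Span B y → Span B (x ∙ y)
    inv  : ∀ {x} → Span B x → Span B (x ⁻¹)
    resp : ∀ {x y} → x ≈ y → Span B x → Span B y

  Generates : {p : Level} → Pred Carrier p → Set (c ⊔ ℓ ⊔ p)
  Generates B = ∀ x → Span B x

  CayleyEdge : {p : Level} → Pred Carrier p → Rel Carrier (c ⊔ ℓ ⊔ p)
  CayleyEdge B x y = ∃ λ g → B g × y ≈ x ∙ g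

  module Cay {p : Level} (B : Pred Carrier p) = Digraph setoid (CayleyEdge B)

{-# OPTIONS --safe #-}

-- Take B = { f x , f x + x } for a function f : G → G.  Every x is then a
-- difference of two elements of B, so any two vertices of Cay(G, B) have a
-- common out-neighbour.  A closed walk of length j ≤ K is a vanishing sum
-- Σ uₜ f(xₜ) + vₜ xₜ with 0 ≤ vₜ ≤ uₜ and Σ uₜ = j, so it suffices to choose f
-- with no such sum (the Haight–Ruzsa method).  This is done by induction on the
-- number of terms, in powers of ℤ/m with m = K! + 1.  Given f on G, adjoin one
-- coordinate y_σ for each function σ : G → ℤ/m, and let the σ-coordinate of the
-- new f be 1 + σ(x) y_σ.  If two of the x's agree in G, their terms merge in G
-- and the induction hypothesis applies; otherwise some σ satisfies
-- uₜ σ(xₜ) = - vₜ for all t, which exists as every u ≤ K is invertible modulo m,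
-- and in its coordinate the sum is Σ uₜ ≠ 0.
module Submission where

open import Defs
open import Algebra.Bundles using (AbelianGroup)
open import Algebra.Structures using (IsAbelianGroup)
open import Data.Fin.Base
  using (Fin; zero; suc; inject₁; fromℕ; toℕ; combine; remQuot; punchIn; punchOut; _↑ˡ_; _↑ʳ_)
import Data.Fin.Properties as Fin
open import Data.Nat.Base
  using (ℕ; zero; suc; _+_; _*_; _∸_; _^_; _≤_; _<_; z≤n; s≤s; NonZero; _!)
open import Data.Nat.DivMod
open import Data.Nat.Divisibility
open import Data.Nat.Properties
open import Data.Nat.Solver using (module +-*-Solver)
open import Data.Product.Base using (_×_; _,_; Σ; ∃; ∃₂; proj₁; proj₂)
open import Data.Sum.Base using (_⊎_; inj₁; inj₂)
open import Data.Vec.Base using (Vec; []; _∷_; lookup; tabulate; zipWith; replicate; map; _++_)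
import Data.Vec.Functional as Vector
open import Data.Vec.Functional using (removeAt; updateAt)
open import Data.Vec.Properties
open import Function.Base using (_∘_; id)
open import Function.Bundles using (Inverse)
open import Level using (0ℓ)
open import Relation.Binary.Construct.Closure.Symmetric using (SymClosure; fwd; bwd)
open import Relation.Binary.Core using (Rel)
open import Relation.Binary.Definitions
  using (DecidableEquality; tri<; tri≈; tri>) renaming (Decidable to Decidable₂)
open import Relation.Binary.PropositionalEquality hiding (resp)
open import Relation.Nullary using (¬_; Dec; yes; no; contradiction)
open import Relation.Nullary.Decidable using (map′; ¬?; _×-dec_; _⊎-dec_; decidable-stable)
open import Relation.Unary using (Pred; Decidable)
open import Algebra.Properties.Semiring.Sum +-*-semiring using (sum; sum-remove; sum-cong-≗; ∑-distrib-+)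

-- Finite digraphs

least : {P : Pred ℕ 0ℓ} → Decidable P → ∀ n → P n → ∃ (IsLeast P)
least P? n       Pn with P? 0
... | yes P0 = 0 , P0 , λ _ _ → z≤n
least P? zero    P0 | no ¬P0 = contradiction P0 ¬P0
least {P} P? (suc n) Pn | no ¬P0 with least (P? ∘ suc) n Pn
... | g , Pg , g≤ = suc g , Pg , suc-g≤
  where
  suc-g≤ : ∀ m → P m → suc g ≤ m
  suc-g≤ zero    P0 = contradiction P0 ¬P0
  suc-g≤ (suc m) Pm = s≤s (g≤ m Pm)

module _ {A : Set} (finite : Finite (setoid A)) where

  open Inverse (proj₂ finite)

  ∃? : {P : Pred A 0ℓ} → Decidable P → Dec (∃ P)
  ∃? {P} P? = map′ (λ (i , p) → to i , p)
                   (λ (x , p) → from x , subst P (sym (inverseˡ refl)) p)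
                   (Fin.any? (P? ∘ to))

  finite⇒decidable-≡ : DecidableEquality A
  finite⇒decidable-≡ x y =
    map′ (λ eq → trans (sym (inverseˡ refl)) (trans (cong to eq) (inverseˡ refl)))
         (cong from) (from x Fin.≟ from y)

-- Closed walks and shortest directed cycles

module FiniteDigraph {A : Set} (finite : Finite (setoid A))
                     {_⟶_ : Rel A 0ℓ} (_⟶?_ : Decidable₂ _⟶_) where

  open Digraph (setoid A) _⟶_

  private
    _≟ᴬ_ = finite⇒decidable-≡ finite

  -- Length and endpoints are indices, so that existence is decidable by recursion on the length.
  data Path : ℕ → A → A → Set where
    []  : ∀ {x} → Path 0 x x
    _∷_ : ∀ {n x y z} → x ⟶ y → Path n y z → Path (suc n) x z

  path? : ∀ n x y → Dec (Path n x y)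
  path? zero    x y = map′ (λ { refl → [] }) (λ { [] → refl }) (x ≟ᴬ y)
  path? (suc n) x y =
    map′ (λ (_ , e , p) → e ∷ p) (λ { (e ∷ p) → _ , e , p })
         (∃? finite λ z → (x ⟶? z) ×-dec path? n z y)

  -- Vertices may repeat here, unlike in `DirectedCycle`, but the least length is the same for both
  -- notions, and this one is easily decided.
  Closed : Pred ℕ 0ℓ
  Closed n = 1 ≤ n × ∃ λ x → Path n x x

  closed? : Decidable Closed
  closed? n = (1 ≤? n) ×-dec ∃? finite (λ x → path? n x x)

  private
    variable
      n : ℕ

  initialPath : (v : Fin (suc n) → A) → IsWalk _⟶_ n v → ∀ j → Path (toℕ j) (v zero) (v j)
  initialPath         v w zero    = []
  initialPath {suc n} v w (suc j) = w zero ∷ initialPath (v ∘ suc) (w ∘ suc) j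

  -- The length has the form `suc l`, so a segment between equal vertices is a closed walk of
  -- positive length.
  segment : (v : Fin (suc n) → A) → IsWalk _⟶_ n v → ∀ {i j} → toℕ i < toℕ j →
            ∃ λ l → suc l + toℕ i ≡ toℕ j × Path (suc l) (v i) (v j)
  segment         v w {zero}  {suc j} _         =
    toℕ j , cong suc (+-identityʳ _) , initialPath v w (suc j)
  segment {suc n} v w {suc i} {suc j} (s≤s i<j) with segment (v ∘ suc) (w ∘ suc) i<j
  ... | l , eq , p = l , trans (+-suc (suc l) _) (cong suc eq) , p

  vertices : ∀ {x y} → Path n x y → Fin (suc n) → A
  vertices {x = x} p       zero    = x
  vertices         (e ∷ p) (suc i) = vertices p i

  vertices-walk : ∀ {x y} (p : Path n x y) → IsWalk _⟶_ n (vertices p)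
  vertices-walk (e ∷ [])      zero    = e
  vertices-walk (e ∷ (_ ∷ _)) zero    = e
  vertices-walk (e ∷ p)       (suc i) = vertices-walk p i

  vertices-end : ∀ {x y} (p : Path n x y) → vertices p (fromℕ n) ≡ y
  vertices-end []      = refl
  vertices-end (e ∷ p) = vertices-end p

  cycle⇒closed : DirectedCycle n → Closed n
  cycle⇒closed {n} (1≤n , v , w , end , _) =
    1≤n , v zero , subst₂ (λ l → Path l (v zero)) (Fin.toℕ-fromℕ n) end (initialPath v w (fromℕ n))

  -- A repetition among the first `n` vertices would cut off a closed walk of positive length below
  -- `n`.
  shortestClosed⇒cycle : IsLeast Closed n → DirectedCycle n
  shortestClosed⇒cycle {n} ((1≤n , x , p) , n≤) =
    1≤n , v , w , vertices-end p , distinct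
    where
    v = vertices p
    w = vertices-walk p

    noRepeat : ∀ {i j : Fin n} → toℕ i < toℕ j → v (inject₁ i) ≢ v (inject₁ j)
    noRepeat {i} {j} i<j eq
      with segment v w (subst₂ _<_ (sym (Fin.toℕ-inject₁ i)) (sym (Fin.toℕ-inject₁ j)) i<j)
    ... | l , l+i≡j , q = <⇒≱ (begin-strict
      suc l                      ≤⟨ m≤m+n _ _ ⟩
      suc l + toℕ (inject₁ i)    ≡⟨ l+i≡j ⟩
      toℕ (inject₁ j)            ≡⟨ Fin.toℕ-inject₁ j ⟩
      toℕ j                      <⟨ Fin.toℕ<n j ⟩
      n                          ∎)
      (n≤ (suc l) (s≤s z≤n , v (inject₁ i) , subst (Path (suc l) (v (inject₁ i))) (sym eq) q))
      where open ≤-Reasoning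

    distinct : ∀ i j → v (inject₁ i) ≡ v (inject₁ j) → i ≡ j
    distinct i j eq with Fin.<-cmp i j
    ... | tri< i<j _ _ = contradiction eq (noRepeat i<j)
    ... | tri≈ _ i≡j _ = i≡j
    ... | tri> _ _ j<i = contradiction (sym eq) (noRepeat j<i)

  -- The given closed walk bounds the search for a shortest one, which is a cycle by
  -- `shortestClosed⇒cycle`.
  girth> : ∀ {K} → (∀ {l} → l ≤ K → ¬ Closed l) → Closed n → ∃ λ g → IsShortestCycleLength g × K < g
  girth> noShort c with least closed? _ c
  ... | g , cg , g≤ =
    g , (shortestClosed⇒cycle (cg , g≤) , λ m → g≤ m ∘ cycle⇒closed) , ≰⇒> (λ g≤K → noShort g≤K cg)

  -- Undirected distances up to two

  Adjacent : Rel A 0ℓ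
  Adjacent x y = x ⟶ y ⊎ y ⟶ x

  walk₀ : ∀ {x y} → UndirectedWalk x y 0 → x ≡ y
  walk₀ (_ , _ , p , q) = trans (sym p) q

  walk₁ : ∀ {x y} → UndirectedWalk x y 1 → Adjacent x y
  walk₁ (_ , w , refl , refl) with w zero
  ... | fwd e = inj₁ e
  ... | bwd e = inj₂ e

  distance₀ : ∀ x → IsUndirectedDistance x x 0
  distance₀ x = ((λ _ → x) , (λ ()) , refl , refl) , λ _ _ → z≤n

  distance₁ : ∀ {x y} → x ≢ y → Adjacent x y → IsUndirectedDistance x y 1
  distance₁ {x} {y} x≢y adj = (v , (λ { zero → edge adj }) , refl , refl) , 1≤
    where
    v : Fin 2 → A
    v zero       = x
    v (suc zero) = y

    edge : Adjacent x y → SymClosure _⟶_ x y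
    edge (inj₁ e) = fwd e
    edge (inj₂ e) = bwd e

    1≤ : ∀ m → UndirectedWalk x y m → 1 ≤ m
    1≤ zero    w = contradiction (walk₀ w) x≢y
    1≤ (suc m) w = s≤s z≤n

  distance₂ : ∀ {x y z} → x ⟶ z → y ⟶ z → x ≢ y → ¬ Adjacent x y → IsUndirectedDistance x y 2
  distance₂ {x} {y} {z} xz yz x≢y ¬adj =
    (v , (λ { zero → fwd xz ; (suc zero) → bwd yz }) , refl , refl) , 2≤
    where
    v : Fin 3 → A
    v zero             = x
    v (suc zero)       = z
    v (suc (suc zero)) = y

    2≤ : ∀ m → UndirectedWalk x y m → 2 ≤ m
    2≤ 0             w = contradiction (walk₀ w) x≢y
    2≤ 1             w = contradiction (walk₁ w) ¬adj
    2≤ (suc (suc m)) w = s≤s (s≤s z≤n)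

  -- The edge `x ⟶ z` and then `y ⟶ z` backwards form a walk of length two; the tests decide whether
  -- a shorter one exists.
  commonTarget⇒distance : (∀ x y → ∃ λ z → x ⟶ z × y ⟶ z) →
                          ∀ x y → ∃ λ n → IsUndirectedDistance x y n × n ≤ 2
  commonTarget⇒distance target x y with x ≟ᴬ y | x ⟶? y | y ⟶? x | target x y
  ... | yes refl | _     | _     | _            = 0 , distance₀ x , z≤n
  ... | no x≢y   | yes e | _     | _            = 1 , distance₁ x≢y (inj₁ e) , s≤s z≤n
  ... | no x≢y   | no _  | yes e | _            = 1 , distance₁ x≢y (inj₂ e) , s≤s z≤n
  ... | no x≢y   | no ¬e | no ¬f | z , xz , yz =
    2 , distance₂ xz yz x≢y (λ { (inj₁ e) → ¬e e ; (inj₂ f) → ¬f f }) , ≤-refl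

-- Powers of ℤ/m

-- The entries become digits in base `m`. The code gives finiteness of the group and also lets
-- functions on the group be stored as vectors.
encode : ∀ {m n} → Vec (Fin m) n → Fin (m ^ n)
encode []       = zero
encode (x ∷ xs) = combine x (encode xs)

decode : ∀ {m} n → Fin (m ^ n) → Vec (Fin m) n
decode         zero    _ = []
decode {m} (suc n) c = proj₁ (remQuot {m} (m ^ n) c) ∷ decode n (proj₂ (remQuot {m} (m ^ n) c))

decode-encode : ∀ {m n} (xs : Vec (Fin m) n) → decode n (encode xs) ≡ xs
decode-encode         []       = refl
decode-encode {m} {suc n} (x ∷ xs) =
  trans (cong (λ (y , c) → y ∷ decode n c) (Fin.remQuot-combine {m} x (encode xs)))
        (cong (x ∷_) (decode-encode xs))

encode-decode : ∀ {m} n (c : Fin (m ^ n)) → encode (decode n c) ≡ c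
encode-decode         zero    zero = refl
encode-decode {m} (suc n) c    =
  trans (cong (combine (proj₁ (remQuot {m} (m ^ n) c))) (encode-decode n _)) (Fin.combine-remQuot {m} (m ^ n) c)

finite-Vec : ∀ m n → Finite (setoid (Vec (Fin m) n))
finite-Vec m n = m ^ n , record
  { to = decode n ; from = encode ; to-cong = cong (decode n) ; from-cong = cong encode
  ; inverse = (λ { refl → decode-encode _ }) , (λ { refl → encode-decode n _ }) }

-- Linear forms and the Haight–Ruzsa construction

n≤n! : ∀ n → n ≤ n !
n≤n! zero    = z≤n
n≤n! (suc n) = subst (_≤ suc n !) (*-identityʳ (suc n)) (*-monoʳ-≤ (suc n) (1≤n! n))

updateAt-* : ∀ {p} (w a : Fin p → ℕ) s c →
             sum (λ t → updateAt w s (c +_) t * a t) ≡ c * a s + sum (λ t → w t * a t)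
updateAt-* {suc p} w a zero    c =
  trans (cong (_+ sum (λ t → w (suc t) * a (suc t))) (*-distribʳ-+ (a zero) c (w zero)))
        (+-assoc (c * a zero) (w zero * a zero) _)
updateAt-* {suc p} w a (suc s) c = begin
  w zero * a zero + _                                        ≡⟨ cong (w zero * a zero +_) (updateAt-* (w ∘ suc) (a ∘ suc) s c) ⟩
  w zero * a zero + (c * a (suc s) + S)                      ≡⟨ solve 3 (λ x y z → x :+ (y :+ z) := y :+ (x :+ z)) refl (w zero * a zero) (c * a (suc s)) S ⟩
  c * a (suc s) + (w zero * a zero + S)                      ∎
  where
  open ≡-Reasoning
  open +-*-Solver
  S = sum (λ t → w (suc t) * a (suc t))

updateAt-mono : ∀ {p} {v u : Fin p → ℕ} {c d} → (∀ t → v t ≤ u t) → c ≤ d →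
                ∀ s t → updateAt v s (c +_) t ≤ updateAt u s (d +_) t
updateAt-mono v≤u c≤d zero    zero    = +-mono-≤ c≤d (v≤u zero)
updateAt-mono v≤u c≤d zero    (suc t) = v≤u (suc t)
updateAt-mono v≤u c≤d (suc s) zero    = v≤u zero
updateAt-mono v≤u c≤d (suc s) (suc t) = updateAt-mono (v≤u ∘ suc) c≤d s t

-- Drops the weight at i and adds it to the one at j.
merge : ∀ {p} {i j : Fin (suc p)} → i ≢ j → (Fin (suc p) → ℕ) → Fin p → ℕ
merge {i = i} i≢j w = updateAt (removeAt w i) (punchOut i≢j) (w i +_)

-- Deleting the term at `i` removes `w i * a i`; the extra weight at `j`, whose new index is
-- `punchOut i≢j`, restores it as `w i * a j`.
merge-* : ∀ {p} {i j : Fin (suc p)} (i≢j : i ≢ j) w (a : Fin (suc p) → ℕ) → a i ≡ a j →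
          sum (λ t → merge i≢j w t * a (punchIn i t)) ≡ sum (λ t → w t * a t)
merge-* {i = i} {j} i≢j w a aᵢ≡aⱼ = begin
  sum (λ t → merge i≢j w t * a (punchIn i t))                    ≡⟨ updateAt-* (removeAt w i) (removeAt a i) (punchOut i≢j) (w i) ⟩
  w i * a (punchIn i (punchOut i≢j)) + sum (removeAt wa i)       ≡⟨ cong (λ b → w i * b + sum (removeAt wa i))
                                                                      (trans (cong a (Fin.punchIn-punchOut i≢j)) (sym aᵢ≡aⱼ)) ⟩
  w i * a i + sum (removeAt wa i)                                ≡⟨ sum-remove wa ⟨
  sum wa                                                         ∎
  where
  open ≡-Reasoning
  wa = λ t → w t * a t

sum-merge : ∀ {p} {i j : Fin (suc p)} (i≢j : i ≢ j) w → sum (merge i≢j w) ≡ sum w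
sum-merge i≢j w = begin
  sum (merge i≢j w)                ≡⟨ sum-cong-≗ (λ t → *-identityʳ (merge i≢j w t)) ⟨
  sum (λ t → merge i≢j w t * 1)    ≡⟨ merge-* i≢j w (λ _ → 1) refl ⟩
  sum (λ t → w t * 1)              ≡⟨ sum-cong-≗ (λ t → *-identityʳ (w t)) ⟩
  sum w                            ∎
  where open ≡-Reasoning

-- Arithmetic modulo m and linear forms on powers of ℤ/m

module Modular (m : ℕ) .{{_ : NonZero m}} where

  infix 4 _≡ₘ_
  _≡ₘ_ : ℕ → ℕ → Set
  a ≡ₘ b = a % m ≡ b % m

  %-≡ₘ : ∀ a → a % m ≡ₘ a
  %-≡ₘ a = m%n%n≡m%n a m

  +-congₘ : ∀ {a b c d} → a ≡ₘ b → c ≡ₘ d → a + c ≡ₘ b + d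
  +-congₘ {a} {b} {c} {d} p q =
    trans (%-distribˡ-+ a c m) (trans (cong₂ (λ x y → (x + y) % m) p q) (sym (%-distribˡ-+ b d m)))

  *-congₘ : ∀ {a b c d} → a ≡ₘ b → c ≡ₘ d → a * c ≡ₘ b * d
  *-congₘ {a} {b} {c} {d} p q =
    trans (%-distribˡ-* a c m) (trans (cong₂ (λ x y → (x * y) % m) p q) (sym (%-distribˡ-* b d m)))

  sum-congₘ : ∀ {p} {f g : Fin p → ℕ} → (∀ t → f t ≡ₘ g t) → sum f ≡ₘ sum g
  sum-congₘ {zero}          eq = refl
  sum-congₘ {suc p} {f} {g} eq = +-congₘ {f zero} {g zero} (eq zero) (sum-congₘ (eq ∘ suc))

  ∣-respₘ : ∀ {a b} → a ≡ₘ b → m ∣ a → m ∣ b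
  ∣-respₘ {a} {b} a≡b m∣a = m%n≡0⇒n∣m b m (trans (sym a≡b) (n∣m⇒m%n≡0 a m m∣a))

  -- Both `r + s` and `r` are the same remainder plus a multiple of `m`, so `s` is a difference of
  -- two multiples.
  +-cancelₘ : ∀ r s → r + s ≡ₘ r → m ∣ s
  +-cancelₘ r s eq = ∣m+n∣m⇒∣n (subst (m ∣_) lem (m∣m*n {m} ((r + s) / m))) (m∣m*n (r / m))
    where
    open ≡-Reasoning
    lem : m * ((r + s) / m) ≡ m * (r / m) + s
    lem = +-cancelˡ-≡ (r % m) _ _ (begin
      r % m + m * ((r + s) / m)          ≡⟨ cong₂ _+_ (sym eq) (*-comm m _) ⟩
      (r + s) % m + (r + s) / m * m      ≡⟨ m≡m%n+[m/n]*n (r + s) m ⟨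
      r + s                              ≡⟨ cong (_+ s) (m≡m%n+[m/n]*n r m) ⟩
      r % m + r / m * m + s              ≡⟨ +-assoc (r % m) _ s ⟩
      r % m + (r / m * m + s)            ≡⟨ cong (λ z → r % m + (z + s)) (*-comm (r / m) m) ⟩
      r % m + (m * (r / m) + s)          ∎)

  toℕ-mod : ∀ a → toℕ (a mod m) ≡ a % m
  toℕ-mod a = Fin.toℕ-fromℕ< (m%n<n a m)

  toℕ-% : (x : Fin m) → toℕ x % m ≡ toℕ x
  toℕ-% x = m<n⇒m%n≡m (Fin.toℕ<n x)

  mod-≡ : ∀ {a} {x : Fin m} → a ≡ₘ toℕ x → a mod m ≡ x
  mod-≡ {a} {x} eq = Fin.toℕ-injective (trans (toℕ-mod a) (trans eq (toℕ-% x)))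

  _⊕_ : Fin m → Fin m → Fin m
  x ⊕ y = (toℕ x + toℕ y) mod m

  0ₘ : Fin m
  0ₘ = 0 mod m

  ⊖_ : Fin m → Fin m
  ⊖ x = (m ∸ toℕ x) mod m

  toℕ-⊕ : ∀ x y → toℕ (x ⊕ y) ≡ₘ toℕ x + toℕ y
  toℕ-⊕ x y = trans (cong (_% m) (toℕ-mod _)) (%-≡ₘ (toℕ x + toℕ y))

  0%m≡0 : 0 % m ≡ 0
  0%m≡0 = n∣m⇒m%n≡0 0 m (m ∣0)

  toℕ-0ₘ : toℕ 0ₘ ≡ 0
  toℕ-0ₘ = trans (toℕ-mod 0) (0%m≡0)

  ⊕-assoc : ∀ x y z → (x ⊕ y) ⊕ z ≡ x ⊕ (y ⊕ z)
  ⊕-assoc x y z = mod-≡ (begin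
    (toℕ (x ⊕ y) + toℕ z) % m          ≡⟨ +-congₘ {toℕ (x ⊕ y)} (toℕ-⊕ x y) refl ⟩
    (toℕ x + toℕ y + toℕ z) % m        ≡⟨ cong (_% m) (+-assoc (toℕ x) (toℕ y) (toℕ z)) ⟩
    (toℕ x + (toℕ y + toℕ z)) % m      ≡⟨ +-congₘ {toℕ x} refl (toℕ-⊕ y z) ⟨
    (toℕ x + toℕ (y ⊕ z)) % m          ≡⟨ toℕ-⊕ x (y ⊕ z) ⟨
    toℕ (x ⊕ (y ⊕ z)) % m              ∎)
    where open ≡-Reasoning

  ⊕-comm : ∀ x y → x ⊕ y ≡ y ⊕ x
  ⊕-comm x y = cong (_mod m) (+-comm (toℕ x) (toℕ y))

  ⊕-identityˡ : ∀ x → 0ₘ ⊕ x ≡ x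
  ⊕-identityˡ x = mod-≡ (cong (λ z → (z + toℕ x) % m) toℕ-0ₘ)

  ⊕-identityʳ : ∀ x → x ⊕ 0ₘ ≡ x
  ⊕-identityʳ x = trans (⊕-comm x 0ₘ) (⊕-identityˡ x)

  ⊕-inverseʳ : ∀ x → x ⊕ (⊖ x) ≡ 0ₘ
  ⊕-inverseʳ x = mod-≡ (begin
    (toℕ x + toℕ (⊖ x)) % m            ≡⟨ +-congₘ {toℕ x} refl (trans (cong (_% m) (toℕ-mod _)) (%-≡ₘ (m ∸ toℕ x))) ⟩
    (toℕ x + (m ∸ toℕ x)) % m          ≡⟨ cong (_% m) (m+[n∸m]≡n (<⇒≤ (Fin.toℕ<n x))) ⟩
    m % m                              ≡⟨ n%n≡0 m ⟩
    0                                  ≡⟨ 0%m≡0 ⟨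
    0 % m                              ≡⟨ cong (_% m) toℕ-0ₘ ⟨
    toℕ 0ₘ % m                         ∎)
    where open ≡-Reasoning

  ⊕-inverseˡ : ∀ x → (⊖ x) ⊕ x ≡ 0ₘ
  ⊕-inverseˡ x = trans (⊕-comm (⊖ x) x) (⊕-inverseʳ x)

  vec-isAbelianGroup : ∀ n → IsAbelianGroup {A = Vec (Fin m) n} _≡_ (zipWith _⊕_) (replicate n 0ₘ) (map ⊖_)
  vec-isAbelianGroup n = record
    { isGroup = record
      { isMonoid = record
        { isSemigroup = record
          { isMagma = record { isEquivalence = isEquivalence ; ∙-cong = cong₂ (zipWith _⊕_) }
          ; assoc   = zipWith-assoc ⊕-assoc
          }
        ; identity = zipWith-identityˡ ⊕-identityˡ , zipWith-identityʳ ⊕-identityʳ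
        }
      ; inverse = zipWith-inverseˡ ⊕-inverseˡ , zipWith-inverseʳ ⊕-inverseʳ
      ; ⁻¹-cong = cong (map ⊖_)
      }
    ; comm = zipWith-comm ⊕-comm
    }

  -- With natural representatives, relations in the group become divisibility by `m` of sums in ℕ.
  residue : ∀ {n} → Vec (Fin m) n → Fin n → ℕ
  residue x i = toℕ (lookup x i)

  residue-∙ : ∀ {n} (x y : Vec (Fin m) n) i → residue (zipWith _⊕_ x y) i ≡ₘ residue x i + residue y i
  residue-∙ x y i = trans (cong (λ z → toℕ z % m) (lookup-zipWith _⊕_ i x y)) (toℕ-⊕ (lookup x i) (lookup y i))

  residue-ε : ∀ {n} (i : Fin n) → residue (replicate n 0ₘ) i ≡ 0
  residue-ε i = trans (cong toℕ (lookup-replicate i 0ₘ)) toℕ-0ₘ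

  residue-injective : ∀ {n} {x y : Vec (Fin m) n} → (∀ i → residue x i ≡ₘ residue y i) → x ≡ y
  residue-injective {x = x} {y} eq = trans (sym (tabulate∘lookup x)) (trans (tabulate-cong eq′) (tabulate∘lookup y))
    where
    eq′ : ∀ i → lookup x i ≡ lookup y i
    eq′ i = Fin.toℕ-injective (trans (sym (toℕ-% _)) (trans (eq i) (toℕ-% _)))

  -- One coordinate of Σ uₜ f(xₜ) + vₜ xₜ, left unreduced in ℕ; it vanishes in ℤ/m exactly when `m`
  -- divides it.
  linearForm : ∀ {p n} → (Vec (Fin m) n → Vec (Fin m) n) → (Fin p → Vec (Fin m) n) → (u v : Fin p → ℕ) → Fin n → ℕ
  linearForm f x u v i = sum λ t → u t * residue (f (x t)) i + v t * residue (x t) i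

  -- Equal points have equal coefficients both for `u` and for `v`, so `merge-*` applies to each
  -- half of the form.
  linearForm-merge : ∀ {p n} f {x : Fin (suc p) → Vec (Fin m) n} u v {i j} (i≢j : i ≢ j) → x i ≡ x j →
                     linearForm f (x ∘ punchIn i) (merge i≢j u) (merge i≢j v) ≗ linearForm f x u v
  linearForm-merge f {x} u v {i} i≢j xᵢ≡xⱼ c = begin
    linearForm f (x ∘ punchIn i) (merge i≢j u) (merge i≢j v) c
      ≡⟨ ∑-distrib-+ (λ t → merge i≢j u t * α (punchIn i t)) (λ t → merge i≢j v t * β (punchIn i t)) ⟩
    sum (λ t → merge i≢j u t * α (punchIn i t)) + sum (λ t → merge i≢j v t * β (punchIn i t))
      ≡⟨ cong₂ _+_ (merge-* i≢j u α (cong (λ z → residue (f z) c) xᵢ≡xⱼ))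
                   (merge-* i≢j v β (cong (λ z → residue z c) xᵢ≡xⱼ)) ⟩
    sum (λ t → u t * α t) + sum (λ t → v t * β t)
      ≡⟨ ∑-distrib-+ (λ t → u t * α t) (λ t → v t * β t) ⟨
    linearForm f x u v c ∎
    where
    open ≡-Reasoning
    α = λ t → residue (f (x t)) c
    β = λ t → residue (x t) c

  -- Adjoining one coordinate for each function to ℤ/m

  module _ {n : ℕ} where
    -- The new coordinates are indexed by codes of the functions σ.
    tables : ℕ
    tables = m ^ (m ^ n)

    evaluate : Fin tables → Vec (Fin m) n → Fin m
    evaluate s z = lookup (decode (m ^ n) s) (encode z)

    table : (Vec (Fin m) n → Fin m) → Fin tables
    table σ = encode (tabulate (σ ∘ decode n))

    evaluate-table : ∀ σ z → evaluate (table σ) z ≡ σ z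
    evaluate-table σ z = begin
      lookup (decode (m ^ n) (table σ)) (encode z)      ≡⟨ cong (λ xs → lookup xs (encode z)) (decode-encode (tabulate (σ ∘ decode n))) ⟩
      lookup (tabulate (σ ∘ decode n)) (encode z)       ≡⟨ lookup∘tabulate (σ ∘ decode n) (encode z) ⟩
      σ (decode n (encode z))                           ≡⟨ cong σ (decode-encode z) ⟩
      σ z                                               ∎
      where open ≡-Reasoning

    base : Vec (Fin m) (n + tables) → Vec (Fin m) n
    base x = tabulate (λ i → lookup x (i ↑ˡ tables))

    residue-base : ∀ x i → residue (base x) i ≡ residue x (i ↑ˡ tables)
    residue-base x i = cong toℕ (lookup∘tabulate (λ i → lookup x (i ↑ˡ tables)) i)

    module _ (f : Vec (Fin m) n → Vec (Fin m) n) where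

      -- The summand 1 contributes the weight `u` of a term. The slope, a function of the old
      -- coordinates alone, is there to cancel `v` times the new coordinate of `x`.
      newCoordinate : Vec (Fin m) (n + tables) → Fin tables → ℕ
      newCoordinate x s = 1 + toℕ (evaluate s (base x)) * residue x (n ↑ʳ s)

      extend : Vec (Fin m) (n + tables) → Vec (Fin m) (n + tables)
      extend x = f (base x) ++ tabulate (λ s → newCoordinate x s mod m)

      extend-↑ˡ : ∀ x i → residue (extend x) (i ↑ˡ tables) ≡ residue (f (base x)) i
      extend-↑ˡ x i = cong toℕ (lookup-++ˡ (f (base x)) _ i)

      extend-↑ʳ : ∀ x s → residue (extend x) (n ↑ʳ s) ≡ newCoordinate x s % m
      extend-↑ʳ x s =
        trans (cong toℕ (trans (lookup-++ʳ (f (base x)) _ s) (lookup∘tabulate (λ s → newCoordinate x s mod m) s)))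
              (toℕ-mod (newCoordinate x s))

      -- On the old coordinates `extend f` acts as `f`, so a hypothesis on `f` can be applied there.
      linearForm-base : ∀ {p} (x : Fin p → Vec (Fin m) (n + tables)) u v i →
                        linearForm extend x u v (i ↑ˡ tables) ≡ linearForm f (base ∘ x) u v i
      linearForm-base x u v i = sum-cong-≗ λ t →
        cong₂ (λ a b → u t * a + v t * b) (extend-↑ˡ (x t) i) (sym (residue-base (x t) i))

-- Induction on the number of terms

module Construction (K m : ℕ) .{{_ : NonZero m}} (m≡1+K! : m ≡ suc (K !)) where

  open Modular m

  -- Closed walks only need `u` equal to 1, but merging terms adds their weights. The induction
  -- raises `q`, while `K` bounds the total weight throughout.
  Nonvanishing : ∀ {n} → ℕ → (Vec (Fin m) n → Vec (Fin m) n) → Set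
  Nonvanishing {n} q f =
    ∀ {p} → p ≤ q → (x : Fin p → Vec (Fin m) n) (u v : Fin p → ℕ) → (∀ t → v t ≤ u t) →
    1 ≤ sum u → sum u ≤ K → ¬ (∀ i → m ∣ linearForm f x u v i)

  -- Since K ! is - 1 modulo m, K ! / u is the inverse of - u.
  slope : ∀ {u v} → v ≤ u → u ≤ K → ∃ λ c → m ∣ u * c + v
  slope {zero}  {zero} z≤n _   = 0 , m ∣0
  slope {suc u} {v}    _   u≤K with ∣-trans (divides (u !) (*-comm (suc u) (u !))) (m≤n⇒m!∣n! u≤K)
  ... | divides q K!≡q*u = v * q , divides v (begin
    suc u * (v * q) + v      ≡⟨ solve 3 (λ u v q → u :* (v :* q) :+ v := v :* (con 1 :+ q :* u)) refl (suc u) v q ⟩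
    v * suc (q * suc u)      ≡⟨ cong (λ z → v * suc z) K!≡q*u ⟨
    v * suc (K !)            ≡⟨ cong (v *_) m≡1+K! ⟨
    v * m                    ∎)
    where
    open ≡-Reasoning
    open +-*-Solver

  slopeₘ : ∀ {u v} → v ≤ u → u ≤ K → ∃ λ (c : Fin m) → m ∣ u * toℕ c + v
  slopeₘ {u} {v} v≤u u≤K with slope v≤u u≤K
  ... | c , m∣uc+v = c mod m ,
    ∣-respₘ {u * c + v} (+-congₘ {u * c} (*-congₘ {u} refl (sym (trans (cong (_% m) (toℕ-mod c)) (%-≡ₘ c)))) refl) m∣uc+v

  term≤sum : ∀ {p} (u : Fin p → ℕ) t → u t ≤ sum u
  term≤sum u zero    = m≤m+n _ _
  term≤sum u (suc t) = ≤-trans (term≤sum (u ∘ suc) t) (m≤n+m _ (u zero))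

  -- Here `s ≤ K ≤ K ! < m`.
  m∤ : ∀ {s} → 1 ≤ s → s ≤ K → ¬ m ∣ s
  m∤ {suc s} _ s≤K m∣s = <⇒≱ (s≤s (≤-trans s≤K (n≤n! K))) (subst (_≤ suc s) m≡1+K! (∣⇒≤ m∣s))

  -- Since `z` does not repeat, the index found for `z t` is `t` itself; away from these points the
  -- value 0 is an arbitrary default.
  interpolate : ∀ {p n} {z : Fin p → Vec (Fin m) n} → (∀ i j → z i ≡ z j → i ≡ j) →
                (c : Fin p → Fin m) → ∃ λ σ → ∀ t → σ (z t) ≡ c t
  interpolate {n = n} {z} inj c = σ , σ-z
    where
    find : ∀ y → Dec (∃ λ t → z t ≡ y)
    find y = Fin.any? λ t → ≡-dec Fin._≟_ (z t) y

    σ : Vec (Fin m) n → Fin m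
    σ y with find y
    ... | yes (t , _) = c t
    ... | no _        = 0ₘ

    σ-z : ∀ t → σ (z t) ≡ c t
    σ-z t with find (z t)
    ... | yes (s , eq) = cong c (inj s t eq)
    ... | no ∄         = contradiction (t , refl) ∄

  extend-nonvanishing : ∀ {n q} {f : Vec (Fin m) n → Vec (Fin m) n} →
                        Nonvanishing q f → Nonvanishing (suc q) (extend f)
  extend-nonvanishing {n} {q} {f} nv {p} p≤ x u v v≤u 1≤u u≤K m∣form
    with Fin.any? (λ i → Fin.any? λ j → ¬? (i Fin.≟ j) ×-dec ≡-dec Fin._≟_ (base {n} (x i)) (base (x j)))
  -- Two points agree in the old coordinates: merging them leaves one term fewer and the same total
  -- weight, and the old coordinates of the form contradict `nv`.
  extend-nonvanishing {n} {q} {f} nv {suc p} (s≤s p≤q) x u v v≤u 1≤u u≤K m∣form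
    | yes (i , j , i≢j , xᵢ≡xⱼ) =
    nv p≤q (base ∘ x ∘ punchIn i) (merge i≢j u) (merge i≢j v)
       (updateAt-mono (v≤u ∘ punchIn i) (v≤u i) (punchOut i≢j))
       (subst (1 ≤_) (sym (sum-merge i≢j u)) 1≤u)
       (subst (_≤ K) (sym (sum-merge i≢j u)) u≤K)
       (λ c → subst (m ∣_) (sym (trans (linearForm-merge f {base ∘ x} u v i≢j xᵢ≡xⱼ c) (sym (linearForm-base f x u v c))))
                    (m∣form (c ↑ˡ tables {n})))
  -- The base points are distinct, so a single σ can take the required slope at each of them; its
  -- coordinate of the form is congruent to `sum u`.
  extend-nonvanishing {n} {q} {f} nv {p} p≤ x u v v≤u 1≤u u≤K m∣form
    | no ∄ = m∤ 1≤u u≤K (∣-respₘ {linearForm (extend f) x u v (n ↑ʳ s)} (sum-congₘ termₘ) (m∣form (n ↑ʳ s)))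
    where
    injective : ∀ i j → base {n} (x i) ≡ base (x j) → i ≡ j
    injective i j eq with i Fin.≟ j
    ... | yes i≡j = i≡j
    ... | no i≢j  = contradiction (i , j , i≢j , eq) ∄

    slopes : ∀ t → ∃ λ (c : Fin m) → m ∣ u t * toℕ c + v t
    slopes t = slopeₘ (v≤u t) (≤-trans (term≤sum u t) u≤K)

    σ = interpolate injective (proj₁ ∘ slopes)
    s = table (proj₁ σ)

    termₘ : ∀ t → u t * residue (extend f (x t)) (n ↑ʳ s) + v t * residue (x t) (n ↑ʳ s) ≡ₘ u t
    termₘ t = begin
      (u t * residue (extend f (x t)) (n ↑ʳ s) + v t * y) % m
        ≡⟨ cong (λ z → (u t * z + v t * y) % m) (extend-↑ʳ f (x t) s) ⟩
      (u t * (newCoordinate f (x t) s % m) + v t * y) % m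
        ≡⟨ +-congₘ {u t * (newCoordinate f (x t) s % m)} (*-congₘ {u t} refl (%-≡ₘ (newCoordinate f (x t) s))) refl ⟩
      (u t * (1 + toℕ (evaluate {n} s (base (x t))) * y) + v t * y) % m
        ≡⟨ cong (λ z → (u t * (1 + toℕ z * y) + v t * y) % m) (trans (evaluate-table (proj₁ σ) (base (x t))) (proj₂ σ t)) ⟩
      (u t * (1 + c * y) + v t * y) % m
        ≡⟨ cong (_% m) (solve 4 (λ u v c y → u :* (con 1 :+ c :* y) :+ v :* y := u :+ (u :* c :+ v) :* y) refl (u t) (v t) c y) ⟩
      -- By the choice of the slope `m` divides `u t * c + v t`, so `y` disappears whatever its
      -- value.
      (u t + (u t * c + v t) * y) % m
        ≡⟨ %-remove-+ʳ (u t) (∣m⇒∣m*n y (proj₂ (slopes t))) ⟩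
      u t % m ∎
      where
      open ≡-Reasoning
      open +-*-Solver
      y = residue (x t) (n ↑ʳ s)
      c = toℕ (proj₁ (slopes t))

  construct : ∀ q → ∃₂ λ n (f : Vec (Fin m) n → Vec (Fin m) n) → Nonvanishing q f
  -- Without terms the total weight is 0, against `1 ≤ sum u`; the trivial group will do.
  construct zero    = 0 , id , λ { z≤n _ _ _ _ () }
  construct (suc q) with construct q
  ... | n , f , nv = _ , extend f , extend-nonvanishing {f = f} nv

-- Cayley graphs of difference bases

module DifferenceBasis
  {A : Set} {_∙_ : A → A → A} {ε : A} {_⁻¹ : A → A}
  (isAbelianGroup : IsAbelianGroup _≡_ _∙_ ε _⁻¹)
  (finite : Finite (setoid A)) (f : A → A) where

  G : AbelianGroup 0ℓ 0ℓ
  G = record { isAbelianGroup = isAbelianGroup }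

  open AbelianGroup G using (group; rawMonoid; assoc; comm; identityˡ; identityʳ)
  open import Algebra.Properties.Group group using (\\-leftDividesˡ; \\-leftDividesʳ)
  open import Algebra.Definitions.RawMonoid rawMonoid using () renaming (_×_ to _·_)

  B : Pred A 0ℓ
  B g = ∃ λ a → g ≡ f a ⊎ g ≡ f a ∙ a

  private
    _≟ᴬ_ = finite⇒decidable-≡ finite

  B? : Decidable B
  B? g = ∃? finite λ a → (g ≟ᴬ f a) ⊎-dec (g ≟ᴬ (f a ∙ a))

  f∈B : ∀ a → B (f a)
  f∈B a = a , inj₁ refl

  f∙∈B : ∀ a → B (f a ∙ a)
  f∙∈B a = a , inj₂ refl

  open FiniteDigraph finite {CayleyEdge group B}
    (λ x y → ∃? finite λ g → B? g ×-dec (y ≟ᴬ (x ∙ g))) public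

  isSubset : IsSubset group B
  isSubset = subst B , B?

  -- Each `x` is the difference of the elements `f x ∙ x` and `f x` of `B`.
  generates : Generates group B
  generates x = subst (Span group B) (\\-leftDividesʳ (f x) x) (mul (inv (gen (f∈B x))) (gen (f∙∈B x)))

  commonTarget : ∀ x y → ∃ λ z → CayleyEdge group B x z × CayleyEdge group B y z
  -- With `d` the difference from `x` to `y`, adding `f d ∙ d` to `x` has the same result as adding
  -- `f d` to `y`.
  commonTarget x y = y ∙ f d , (f d ∙ d , f∙∈B d , eq) , (f d , f∈B d , refl)
    where
    d = (x ⁻¹) ∙ y
    open ≡-Reasoning
    eq : y ∙ f d ≡ x ∙ (f d ∙ d)
    eq = begin
      y ∙ f d             ≡⟨ cong (_∙ f d) (\\-leftDividesˡ x y) ⟨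
      (x ∙ d) ∙ f d       ≡⟨ assoc x d (f d) ⟩
      x ∙ (d ∙ f d)       ≡⟨ cong (x ∙_) (comm d (f d)) ⟩
      x ∙ (f d ∙ d)       ∎

  edge-ε : ∀ {y} → CayleyEdge group B ε y → B y
  edge-ε (g , g∈B , y≡) = subst B (sym (trans y≡ (identityˡ g))) g∈B

  path-· : ∀ {b} → B b → ∀ n x → Path n x (x ∙ (n · b))
  path-·     b∈B zero    x = subst (Path 0 x) (sym (identityʳ x)) []
  path-· {b} b∈B (suc n) x = (b , b∈B , refl) ∷ subst (Path n (x ∙ b)) (assoc x b _) (path-· b∈B n (x ∙ b))

  module _ {m : ℕ} (torsion : ∀ x → suc m · x ≡ ε) where

    -- Repeating the generator `f ε` returns to `ε`. This is the closed walk that starts the search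
    -- for the girth.
    closed-torsion : Closed (suc m)
    closed-torsion = s≤s z≤n , ε , subst (Path (suc m) ε) (trans (identityˡ _) (torsion _)) (path-· (f∈B ε) (suc m) ε)

    module _ {K : ℕ} (3≤K : 3 ≤ K) (noShort : ∀ {n} → n ≤ K → ¬ Closed n) where

      -- A zero generator would give a loop.
      ε∉B : ¬ B ε
      ε∉B ε∈B = noShort (≤-trans (s≤s z≤n) 3≤K) (s≤s z≤n , ε , ((ε , ε∈B , sym (identityˡ ε)) ∷ []))

      -- The first multiple y of b outside B is at distance 2 from ε: as a sum of
      -- two elements of B, it would close a walk of length 3 if - y were in B.
      lastMultiple : ∀ {b} → B b → ∃ λ n → B (suc n · b) × ¬ B (suc (suc n) · b)
      -- Torsion bounds the search: `suc m · b` is `ε`, which lies outside `B`.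
      lastMultiple {b} b∈B with least (λ n → ¬? (B? (suc n · b))) m (subst (¬_ ∘ B) (sym (torsion b)) ε∉B)
      ... | zero  , b∉B , _ = contradiction (subst B (sym (identityʳ b)) b∈B) b∉B
      ... | suc n , ∉B  , n≤ =
        n , decidable-stable (B? _) (λ ∉B′ → <⇒≱ (n<1+n n) (n≤ n ∉B′)) , ∉B

      -- A diameter has to be attained, so an upper bound of 2 is not enough.
      distance-two : ∃₂ λ x y → Digraph.IsUndirectedDistance (setoid A) (CayleyEdge group B) x y 2
      distance-two with lastMultiple (f∈B ε)
      ... | n , c∈B , bc∉B with commonTarget ε (f ε ∙ (suc n · f ε))
      ...   | z , ez , yz = ε , y , distance₂ ez yz ε≢y ¬adj
        where
        b = f ε
        c = suc n · b
        y = b ∙ c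

        path : Path 2 ε y
        path = (b , f∈B ε , sym (identityˡ b)) ∷ ((c , c∈B , refl) ∷ [])

        ε≢y : ε ≢ y
        ε≢y ε≡y = noShort (≤-trans (s≤s (s≤s z≤n)) 3≤K) (s≤s z≤n , ε , subst (Path 2 ε) (sym ε≡y) path)

        ¬adj : ¬ Adjacent ε y
        ¬adj (inj₁ e) = bc∉B (edge-ε e)
        ¬adj (inj₂ e) = noShort 3≤K (s≤s z≤n , y , e ∷ path)

      diameter : Digraph.IsUndirectedDiameter (setoid A) (CayleyEdge group B) 2
      diameter = commonTarget⇒distance commonTarget , distance-two

-- Closed walks as vanishing linear forms

module Girth (K m : ℕ) .{{_ : NonZero m}} (m≡1+K! : m ≡ suc (K !))
             {n : ℕ} (f : Vec (Fin m) n → Vec (Fin m) n) where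

  open Modular m
  open Construction K m m≡1+K!

  open DifferenceBasis (vec-isAbelianGroup n) (finite-Vec m n) f public

  ones : ∀ {p} → Fin p → ℕ
  ones _ = 1

  sum-ones : ∀ p → sum (ones {p}) ≡ p
  sum-ones zero    = refl
  sum-ones (suc p) = cong suc (sum-ones p)

  -- The two kinds of generators are terms of weight `u = 1` with `v = 0` and `v = 1`.
  residue-B : ∀ {g} → B g → ∃₂ λ a v → v ≤ 1 × (∀ i → residue g i ≡ₘ 1 * residue (f a) i + v * residue a i)
  residue-B (a , inj₁ refl) = a , 0 , z≤n , λ i →
    cong (_% m) (sym (trans (+-identityʳ _) (*-identityˡ _)))
  residue-B (a , inj₂ refl) = a , 1 , ≤-refl , λ i →
    trans (residue-∙ (f a) a i)
          (cong (_% m) (sym (cong₂ _+_ (*-identityˡ (residue (f a) i)) (*-identityˡ (residue a i)))))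

  -- Every edge contributes one term of weight 1, so the total weight is the length of the walk.
  path⇒linearForm : ∀ {p x y} → Path p x y →
    ∃₂ λ (a : Fin p → Vec (Fin m) n) v → (∀ t → v t ≤ 1) ×
       (∀ i → residue x i + linearForm f a ones v i ≡ₘ residue y i)
  path⇒linearForm []  = (λ ()) , (λ ()) , (λ ()) , λ i → cong (_% m) (+-identityʳ _)
  path⇒linearForm {x = x} {y} ((g , g∈B , refl) ∷ path) with residue-B g∈B | path⇒linearForm path
  ... | a , v , v≤1 , g≡ | as , vs , vs≤1 , eq =
    a Vector.∷ as , v Vector.∷ vs , (λ { zero → v≤1 ; (suc t) → vs≤1 t }) , λ i → begin
      (residue x i + (h i + S i)) % m                       ≡⟨ cong (_% m) (+-assoc (residue x i) (h i) (S i)) ⟨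
      (residue x i + h i + S i) % m                         ≡⟨ +-congₘ {c = S i} (+-congₘ {residue x i} refl (g≡ i)) refl ⟨
      (residue x i + residue g i + S i) % m                 ≡⟨ +-congₘ {c = S i} (residue-∙ x g i) refl ⟨
      (residue (zipWith _⊕_ x g) i + S i) % m               ≡⟨ eq i ⟩
      residue y i % m                                       ∎
    where
    open ≡-Reasoning
    h = λ i → 1 * residue (f a) i + v * residue a i
    S = linearForm f as ones vs

  -- On a closed walk the residues of the endpoints cancel, so `m` divides every coordinate of the
  -- form. The length `p` is both the number of terms and the total weight.
  noShortClosed : Nonvanishing K f → ∀ {p} → p ≤ K → ¬ Closed p
  noShortClosed nv {p} p≤K (1≤p , x , path) with path⇒linearForm path
  ... | a , v , v≤1 , eq =
    nv p≤K a ones v v≤1 (subst (1 ≤_) (sym (sum-ones p)) 1≤p) (subst (_≤ K) (sym (sum-ones p)) p≤K)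
       (λ i → +-cancelₘ (residue x i) (linearForm f a ones v i) (eq i))

  open import Algebra.Definitions.RawMonoid (AbelianGroup.rawMonoid G) using () renaming (_×_ to _·_)

  residue-· : ∀ q x i → residue (q · x) i ≡ₘ q * residue x i
  residue-· zero    x i = cong (_% m) (residue-ε i)
  residue-· (suc q) x i = trans (residue-∙ x (q · x) i) (+-congₘ {residue x i} refl (residue-· q x i))

  torsion : ∀ x → m · x ≡ replicate n 0ₘ
  torsion x = residue-injective λ i → begin
    residue (m · x) i % m            ≡⟨ residue-· m x i ⟩
    (m * residue x i) % m            ≡⟨ n∣m⇒m%n≡0 _ m (m∣m*n _) ⟩
    0                                ≡⟨ 0%m≡0 ⟨
    0 % m                            ≡⟨ cong (_% m) (residue-ε i) ⟨
    residue (replicate n 0ₘ) i % m   ∎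
    where open ≡-Reasoning

proposition5p3 : (k : ℕ) → 1 ≤ k →
    Σ (AbelianGroup 0ℓ 0ℓ) λ G →
    Σ (Pred (AbelianGroup.Carrier G) 0ℓ) λ B →
    Finite (AbelianGroup.setoid G) ×
    IsSubset (AbelianGroup.group G) B ×
    Generates (AbelianGroup.group G) B ×
    (∃ λ d → Cay.IsUndirectedDiameter (AbelianGroup.group G) B d × d ≤ 2) ×
    (∃ λ g → Cay.IsShortestCycleLength (AbelianGroup.group G) B g × k ≤ g)
-- The choice `K = 3 + k` provides `3 ≤ K` for the diameter and a girth above `k`. The modulus is
-- `suc M` with `M = K !`, and `K` steps of the induction cover all closed walks of length at most
-- `K`.
proposition5p3 k _ with (3 + k) ! in K!≡M
... | M with Construction.construct (3 + k) (suc M) (cong suc (sym K!≡M)) (3 + k)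
...   | n , f , nv =
  G , B , finite-Vec (suc M) n , isSubset , generates ,
  (2 , diameter {M} torsion (m≤m+n 3 k) (noShortClosed nv) , ≤-refl) ,
  (proj₁ shortest , proj₁ (proj₂ shortest) , ≤-trans (m≤n+m k 3) (<⇒≤ (proj₂ (proj₂ shortest))))
  where
  open Girth (3 + k) (suc M) (cong suc (sym K!≡M)) f
  shortest = girth> (noShortClosed nv) (closed-torsion {M} torsion)
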